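{- For every finite simple graph $H$: (i) $\rho(H)\le\rho_R(H)$. (ii) If $H'$ is obtained from $H$ by removing some edges (keeping all vertices), then $\rho_R(H')\ge\rho_R(H)$. (iii) If $H$ is the union of two vertex-disjoint graphs $H_1$ and $H_2$ together with possibly some additional edges between $V(H_1)$ and $V(H_2)$, and $m(H_1,H_2)$ denotes the number of pairs $(u,v)$ with $u\in V(H_1)$, $v\in V(H_2)$, $uv\notin E(H)$, then $$\rho_R(H_1)+\rho_R(H_2)\le\rho_R(H)\le\rho_R(H_1)+\rho_R(H_2)+m(H_1,H_2).$$
   Context: All graphs are finite and simple. A coloring means a proper vertex coloring; an induced subgraph is rainbow if all its vertices have pairwise different colors. $\rho(H)$ is the least number $m$ such that some graph $G$ on $m$ vertices has the property that every proper vertex coloring of $G$ contains a rainbow induced subgraph isomorphic to $H$. If $V(H)=\{h_1,\ldots,h_n\}$, a replication graph of $H$ is a graph $G$ obtained by replacing each vertex $h_i$ by a clique $K_i$ with $|K_i|\ge1$ (cliques pairwise vertex-disjoint), where two vertices in different cliques $K_i,K_j$ are adjacent iff $h_ih_j\in E(H)$. $\rho_R(H)$ is the minimum order of a replication graph $G$ of $H$ such that every proper vertex coloring of $G$ admits a choice of exactly one vertex from each clique $K_i$ with all chosen vertices of pairwise different colors (such a choice induces a rainbow copy of $H$). -}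

module Defs where

open import Data.Bool using (Bool; true; false; not; T; if_then_else_)
open import Data.Bool.Properties using (T?)
  renaming (_≟_ to _≟ᵇ_)
open import Data.Fin using (Fin; zero; suc; toℕ; fromℕ<; inject≤; _≟_)
open import Data.Fin.Properties
  using (toℕ-injective; toℕ-fromℕ<; toℕ-inject≤;
         any?; all?; pigeonhole; <⇒≢; +↔⊎)
open import Data.Nat using (ℕ; zero; suc; _+_; _≤_; _<_; z≤n; s≤s; _≤?_)
  renaming (_≟_ to _≟ⁿ_)
open import Data.Nat.Properties
  using (+-0-commutativeMonoid; ≤-reflexive; ≤-trans; m≤m+n; m≤n+m; ≤-refl;
         suc-injective; n≤1+n)
open import Data.Product using (Σ; ∃; _×_; _,_; proj₁; proj₂)
open import Data.Sum using (_⊎_; inj₁; inj₂)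
open import Data.Sum.Function.Propositional using (_⊎-↔_)
open import Function using (_∘_)
open import Function.Bundles using (_↔_; Inverse; mk↔ₛ′)
open import Function.Construct.Composition using (_↔-∘_)
open import Function.Construct.Identity using (↔-id)
open import Function.Construct.Symmetry using (↔-sym)
open import Function.Definitions using (Injective)
open import Level using (0ℓ)
open import Relation.Binary.Core using (Rel)
open import Relation.Binary.Definitions using (_Respects_; DecidableEquality)
open import Relation.Binary.PropositionalEquality
  using (_≡_; _≢_; refl; sym; trans; cong; cong₂; subst)
open import Relation.Nullary using (¬_; Dec; yes; no; contradiction)
open import Relation.Nullary.Decidable
  using (map′; ⌊_⌋; _×-dec_; _→-dec_; ¬?; decidable-stable)
open import Relation.Unary using (Decidable)

open import Algebra.Properties.CommutativeMonoid.Sum +-0-commutativeMonoid public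
  using (sum; sum-syntax)

-- Adjacency is Boolean-valued because the graphs considered are finite;
-- finiteness comes from the vertex type, e.g. `Graph (Fin n)`.
record Graph (V : Set) : Set where
  field
    adj       : V → V → Bool
    symmetric : ∀ u v → adj u v ≡ adj v u
    loopless  : ∀ v → adj v v ≡ false

open Graph public

private
  variable
    n a b m : ℕ
    V W     : Set

Proper : Graph V → (V → ℕ) → Set
Proper G c = ∀ u v → T (adj G u v) → c u ≢ c v

RainbowCopy : Graph W → (G : Graph V) → (V → ℕ) → Set
RainbowCopy {W} {V} H G c = Σ (W → V) λ f →
  Injective _≡_ _≡_ f ×
  (∀ i j → adj G (f i) (f j) ≡ adj H i j) ×
  Injective _≡_ _≡_ (c ∘ f)

Forces : Graph W → Graph V → Set
Forces H G = ∀ c → Proper G c → RainbowCopy H G c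

-- Vertex set of the replication graph with |K i| = k i: the vertex (i , x) is
-- the x-th vertex of the clique K i.
Blowup : (Fin n → ℕ) → Set
Blowup {n} k = Σ (Fin n) (Fin ∘ k)

replicationAdj : Graph (Fin n) → (k : Fin n → ℕ) → Blowup k → Blowup k → Bool
replicationAdj H k (i , x) (j , y) with i ≟ j
... | yes _ = not ⌊ toℕ x ≟ⁿ toℕ y ⌋
... | no  _ = adj H i j

≟ⁿ-comm : ∀ x y → not ⌊ x ≟ⁿ y ⌋ ≡ not ⌊ y ≟ⁿ x ⌋
≟ⁿ-comm x y with x ≟ⁿ y | y ≟ⁿ x
... | yes _ | yes _ = refl
... | yes p | no ¬q = contradiction (sym p) ¬q
... | no ¬p | yes q = contradiction (sym q) ¬p
... | no  _ | no  _ = refl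

replicationAdj-sym : (H : Graph (Fin n)) (k : Fin n → ℕ) →
  ∀ u v → replicationAdj H k u v ≡ replicationAdj H k v u
replicationAdj-sym H k (i , x) (j , y) with i ≟ j | j ≟ i
... | yes _ | yes _ = ≟ⁿ-comm (toℕ x) (toℕ y)
... | yes p | no ¬q = contradiction (sym p) ¬q
... | no ¬p | yes q = contradiction (sym q) ¬p
... | no  _ | no  _ = symmetric H i j

replicationAdj-irr : (H : Graph (Fin n)) (k : Fin n → ℕ) →
  ∀ v → replicationAdj H k v v ≡ false
replicationAdj-irr H k (i , x) with i ≟ i
... | no ¬p = contradiction refl ¬p
... | yes _ with toℕ x ≟ⁿ toℕ x
...   | yes _ = refl
...   | no ¬p = contradiction refl ¬p

replication : Graph (Fin n) → (k : Fin n → ℕ) → Graph (Blowup k)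
replication H k = record
  { adj       = replicationAdj H k
  ; symmetric = replicationAdj-sym H k
  ; loopless  = replicationAdj-irr H k
  }

ForcesChoice : Graph (Fin n) → (Fin n → ℕ) → Set
ForcesChoice {n} H k = ∀ c → Proper (replication H k) c →
  Σ ((i : Fin n) → Fin (k i)) λ s → Injective _≡_ _≡_ (λ i → c (i , s i))

ForcedAt : Graph (Fin n) → ℕ → Set
ForcedAt H m = Σ (Graph (Fin m)) (Forces H)

-- sum k is the order of the replication graph; see Blowup↔Fin below.
ReplicationForcedAt : Graph (Fin n) → ℕ → Set
ReplicationForcedAt {n} H m = Σ (Fin n → ℕ) λ k →
  (∀ i → 1 ≤ k i) × sum k ≡ m × ForcesChoice H k

Least : (ℕ → Set) → ℕ → Set
Least P m = P m × (∀ k → P k → m ≤ k)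

-- Constructively, the minima exist because both predicates are decidable and
-- satisfied by some m; this is what is established from here up to the
-- definition of ρ and ρᴿ.

least : {P : ℕ → Set} → Decidable P → ∀ b → P b → ∃ (Least P)
least P? zero    pb = zero , pb , λ _ _ → z≤n
least P? (suc b) pb with P? zero
... | yes p0 = zero , p0 , λ _ _ → z≤n
... | no ¬p0 with least (P? ∘ suc) b pb
...   | m , pm , min = suc m , pm , λ where
        zero    p0 → contradiction p0 ¬p0
        (suc k) pk → s≤s (min k pk)

Searchable : (A : Set) → Rel A 0ℓ → Set₁
Searchable A _≈_ = ∀ {P : A → Set} → P Respects _≈_ → Decidable P → Dec (∃ P)

search-Fin : Searchable (Fin n) _≡_
search-Fin _ = any?

search-Bool : Searchable Bool _≡_
search-Bool _ P? with P? true | P? false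
... | yes p | _     = yes (true , p)
... | no _  | yes q = yes (false , q)
... | no ¬p | no ¬q = no λ { (true , p) → ¬p p ; (false , q) → ¬q q }

none : {A : Fin zero → Set} → ∀ i → A i
none ()

cons : {A : Fin (suc n) → Set} → A zero → (∀ i → A (suc i)) → ∀ i → A i
cons x f zero    = x
cons x f (suc i) = f i

search-Π : {A : Fin n → Set} {_≈_ : ∀ {i} → Rel (A i) 0ℓ} →
           (∀ {i} {x : A i} → x ≈ x) → (∀ i → Searchable (A i) _≈_) →
           Searchable (∀ i → A i) (λ f g → ∀ i → f i ≈ g i)
search-Π {zero} rfl search resp P? =
  map′ (λ p → none , p) (λ { (f , p) → resp (λ ()) p }) (P? none)
search-Π {suc n} {A} {_≈_} rfl search {P} resp P? =
  map′ (λ { (x , f , p) → cons x f , p })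
       (λ { (f , p) → f zero , f ∘ suc , resp (η f) p })
       (search zero
         (λ { x≈y (f , p) → f , resp (cons-cong x≈y λ _ → rfl) p })
         λ x → search-Π rfl (search ∘ suc)
                 (λ f≈g → resp (cons-cong rfl f≈g)) (P? ∘ cons x))
  where
  η : ∀ f i → f i ≈ cons {A = A} (f zero) (f ∘ suc) i
  η f zero    = rfl
  η f (suc i) = rfl

  cons-cong : ∀ {x y : A zero} {f g : ∀ i → A (suc i)} → x ≈ y →
              (∀ i → f i ≈ g i) → ∀ i → cons {A = A} x f i ≈ cons {A = A} y g i
  cons-cong x≈y f≈g zero    = x≈y
  cons-cong x≈y f≈g (suc i) = f≈g i

search⇒all? : {A : Set} {_≈_ : Rel A 0ℓ} → (∀ {x y} → x ≈ y → y ≈ x) →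
              Searchable A _≈_ → {P : A → Set} → P Respects _≈_ →
              Decidable P → Dec (∀ x → P x)
search⇒all? ≈-sym search resp P?
  with search (λ x≈y ¬px py → ¬px (resp (≈-sym x≈y) py)) (¬? ∘ P?)
... | yes (x , ¬px) = no λ all → ¬px (all x)
... | no  ∄¬p       = yes λ x → decidable-stable (P? x) λ ¬px → ∄¬p (x , ¬px)

injective? : {A : Set} → DecidableEquality A → (f : Fin n → A) →
             Dec (Injective _≡_ _≡_ f)
injective? _≟′_ f = map′ (λ h {i} {j} → h i j) (λ h i j → h)
  (all? λ i → all? λ j → (f i ≟′ f j) →-dec (i ≟ j))

injective-cong : {A B : Set} {f g : A → B} → (∀ i → f i ≡ g i) →
                 Injective _≡_ _≡_ f → Injective _≡_ _≡_ g
injective-cong f≗g inj {i} {j} eq =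
  inj (trans (f≗g i) (trans eq (sym (f≗g j))))

-- A colouring matters only up to its kernel, so for m vertices it is enough to
-- search colourings with m colours.
SameKernel : (c c′ : V → ℕ) → Set
SameKernel c c′ = ∀ u v → (c u ≡ c v → c′ u ≡ c′ v) × (c′ u ≡ c′ v → c u ≡ c v)

-- Position of the first occurrence of z among the values of g.
index : (Fin m → ℕ) → ℕ → ℕ
index {zero}  g z = 0
index {suc m} g z with g zero ≟ⁿ z
... | yes _ = 0
... | no  _ = suc (index (g ∘ suc) z)

index-< : (g : Fin m → ℕ) → ∀ {z} i → g i ≡ z → index g z < m
index-< {suc m} g {z} i gi≡z with g zero ≟ⁿ z
... | yes _ = s≤s z≤n
index-< {suc m} g zero    gi≡z | no ¬p = contradiction gi≡z ¬p
index-< {suc m} g (suc i) gi≡z | no ¬p = s≤s (index-< (g ∘ suc) i gi≡z)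

index-inj : (g : Fin m → ℕ) → ∀ {z w} i j → g i ≡ z → g j ≡ w →
            index g z ≡ index g w → z ≡ w
index-inj {suc m} g {z} {w} i j p q eq with g zero ≟ⁿ z | g zero ≟ⁿ w
... | yes r | yes s = trans (sym r) s
index-inj g zero    j       p q eq | no ¬r | no _  = contradiction p ¬r
index-inj g (suc i) zero    p q eq | no _  | no ¬s = contradiction q ¬s
index-inj g (suc i) (suc j) p q eq | no _  | no _  =
  index-inj (g ∘ suc) i j p q (suc-injective eq)

allColourings? : V ↔ Fin m → {P : (V → ℕ) → Set} →
                 (∀ {c c′} → SameKernel c c′ → P c → P c′) →
                 Decidable P → Dec (∀ c → P c)
allColourings? {V} {m} V↔ {P} invariant P? =
  map′ (λ h c → invariant (kernel c) (h (canon c))) (λ h d → h (toℕ ∘ d ∘ to))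
    (search⇒all? (λ f≗g i → sym (f≗g i)) (search-Π refl λ _ → search-Fin)
      (λ f≗g → invariant λ u v →
        (λ eq → trans (cong toℕ (sym (f≗g (to u)))) (trans eq (cong toℕ (f≗g (to v))))) ,
        (λ eq → trans (cong toℕ (f≗g (to u))) (trans eq (cong toℕ (sym (f≗g (to v)))))))
      (λ d → P? (toℕ ∘ d ∘ to)))
  where
  open Inverse V↔ using (to; from; strictlyInverseʳ)

  occurs : (c : V → ℕ) → ∀ v → c (from (to v)) ≡ c v
  occurs c v = cong c (strictlyInverseʳ v)

  canon : (V → ℕ) → Fin m → Fin m
  canon c i = fromℕ< (index-< (c ∘ from) {c (from i)} i refl)

  toℕ-canon : ∀ c v → toℕ (canon c (to v)) ≡ index (c ∘ from) (c v)
  toℕ-canon c v = trans (toℕ-fromℕ< _) (cong (index (c ∘ from)) (occurs c v))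

  kernel : ∀ c → SameKernel (toℕ ∘ canon c ∘ to) c
  kernel c u v =
    (λ eq → index-inj (c ∘ from) (to u) (to v) (occurs c u) (occurs c v)
              (trans (sym (toℕ-canon c u)) (trans eq (toℕ-canon c v)))) ,
    (λ eq → trans (toℕ-canon c u)
              (trans (cong (index (c ∘ from)) eq) (sym (toℕ-canon c v))))

proper? : V ↔ Fin m → (G : Graph V) → Decidable (Proper G)
proper? V↔ G c =
  map′ (λ h u v a eq → h (to u) (to v)
          (subst T (sym (cong₂ (adj G) (strictlyInverseʳ u) (strictlyInverseʳ v))) a)
          (trans (cong c (strictlyInverseʳ u)) (trans eq (sym (cong c (strictlyInverseʳ v))))))
       (λ h i j → h (from i) (from j))
       (all? λ i → all? λ j →
         T? (adj G (from i) (from j)) →-dec ¬? (c (from i) ≟ⁿ c (from j)))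
  where open Inverse V↔ using (to; from; strictlyInverseʳ)

proper-invariant : (G : Graph V) {c c′ : V → ℕ} → SameKernel c c′ →
                   Proper G c′ → Proper G c
proper-invariant G same prop u v a eq = prop u v a (proj₁ (same u v) eq)

rainbowCopy? : (H : Graph (Fin n)) (G : Graph (Fin m)) → Decidable (RainbowCopy H G)
rainbowCopy? H G c = search-Π refl (λ _ → search-Fin)
  (λ f≗g (inj , copy , rainbow) →
    injective-cong f≗g inj ,
    (λ i j → trans (sym (cong₂ (adj G) (f≗g i) (f≗g j))) (copy i j)) ,
    injective-cong (cong c ∘ f≗g) rainbow)
  (λ f →
    injective? _≟_ f
    ×-dec (all? λ i → all? λ j → adj G (f i) (f j) ≟ᵇ adj H i j)
    ×-dec injective? _≟ⁿ_ (c ∘ f))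

forces? : (H : Graph (Fin n)) (G : Graph (Fin m)) → Dec (Forces H G)
forces? H G = allColourings? (↔-id _)
  (λ same h prop → let f , inj , copy , rainbow = h (proper-invariant G same prop) in
    f , inj , copy , λ {i} {j} eq → rainbow (proj₂ (same (f i) (f j)) eq))
  (λ c → proper? (↔-id _) G c →-dec rainbowCopy? H G c)

forces-cong : (H : Graph W) {G G′ : Graph V} →
              (∀ u v → adj G u v ≡ adj G′ u v) → Forces H G → Forces H G′
forces-cong H {G} {G′} eq h c prop =
  let f , inj , copy , rainbow = h c (λ u v a → prop u v (subst T (eq u v) a)) in
  f , inj , (λ i j → trans (sym (eq (f i) (f j))) (copy i j)) , rainbow

forcedAt? : (H : Graph (Fin n)) → Decidable (ForcedAt H)
forcedAt? H m =
  map′ (λ { (A , s , l , h) → graph A s l , h })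
       (λ { (G , h) → adj G , symmetric G , loopless G , h })
       (search-Π (λ _ → refl) (λ _ → search-Π refl λ _ → search-Bool) resp Q?)
  where
  graph : (A : Fin m → Fin m → Bool) → (∀ u v → A u v ≡ A v u) →
          (∀ v → A v v ≡ false) → Graph (Fin m)
  graph A s l = record { adj = A ; symmetric = s ; loopless = l }

  Q : (Fin m → Fin m → Bool) → Set
  Q A = Σ (∀ u v → A u v ≡ A v u) λ s → Σ (∀ v → A v v ≡ false) λ l →
        Forces H (graph A s l)

  resp : Q Respects (λ A B → ∀ u v → A u v ≡ B u v)
  resp {A} {B} A≗B (s , l , h) =
    s′ , l′ , forces-cong H {graph A s l} {graph B s′ l′} A≗B h
    where
    s′ : ∀ u v → B u v ≡ B v u
    s′ u v = trans (sym (A≗B u v)) (trans (s u v) (A≗B v u))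

    l′ : ∀ v → B v v ≡ false
    l′ v = trans (sym (A≗B v v)) (l v)

  Q? : Decidable Q
  Q? A with all? (λ u → all? λ v → A u v ≟ᵇ A v u) | all? (λ v → A v v ≟ᵇ false)
  ... | no ¬s | _     = no λ q → ¬s (proj₁ q)
  ... | yes _ | no ¬l = no λ q → ¬l (proj₁ (proj₂ q))
  ... | yes s | yes l = map′
    (λ h → s , l , h)
    (λ { (s′ , l′ , h) →
         forces-cong H {graph A s′ l′} {graph A s l} (λ _ _ → refl) h })
    (forces? H (graph A s l))

Blowup↔Fin : (k : Fin n → ℕ) → Blowup k ↔ Fin (sum k)
Blowup↔Fin {zero}  k = mk↔ₛ′ (λ ()) (λ ()) (λ ()) (λ ())
Blowup↔Fin {suc n} k =
  ↔-sym +↔⊎ ↔-∘ ((↔-id _ ⊎-↔ Blowup↔Fin (k ∘ suc)) ↔-∘ split)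
  where
  split : Blowup k ↔ (Fin (k zero) ⊎ Blowup (k ∘ suc))
  split = mk↔ₛ′
    (λ { (zero , x) → inj₁ x ; (suc i , x) → inj₂ (i , x) })
    (λ { (inj₁ x) → zero , x ; (inj₂ (i , x)) → suc i , x })
    (λ { (inj₁ _) → refl ; (inj₂ _) → refl })
    (λ { (zero , _) → refl ; (suc _ , _) → refl })

forcesChoice? : (H : Graph (Fin n)) → Decidable (ForcesChoice H)
forcesChoice? H k = allColourings? (Blowup↔Fin k)
  (λ same h prop → let s , inj = h (proper-invariant (replication H k) same prop) in
    s , λ {i} {j} eq → inj (proj₂ (same (i , s i) (j , s j)) eq))
  (λ c → proper? (Blowup↔Fin k) (replication H k) c →-dec
    search-Π refl (λ _ → search-Fin)
      (λ s≗t → injective-cong λ i → cong (λ x → c (i , x)) (s≗t i))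
      (λ s → injective? _≟ⁿ_ λ i → c (i , s i)))

inject : {k l : Fin n → ℕ} → (∀ i → k i ≤ l i) → Blowup k → Blowup l
inject k≤l (i , x) = i , inject≤ x (k≤l i)

inject-adj : (H : Graph (Fin n)) {k l : Fin n → ℕ} (k≤l : ∀ i → k i ≤ l i) →
  ∀ u v → replicationAdj H l (inject k≤l u) (inject k≤l v) ≡ replicationAdj H k u v
inject-adj H k≤l (i , x) (j , y) with i ≟ j
... | yes _ = cong₂ (λ a b → not ⌊ a ≟ⁿ b ⌋)
                (toℕ-inject≤ x (k≤l i)) (toℕ-inject≤ y (k≤l j))
... | no  _ = refl

forcesChoice-mono : (H : Graph (Fin n)) {k l : Fin n → ℕ} → (∀ i → k i ≤ l i) →
                    ForcesChoice H k → ForcesChoice H l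
forcesChoice-mono H k≤l h c prop =
  let s , inj = h (c ∘ inject k≤l)
                  (λ u v a → prop _ _ (subst T (sym (inject-adj H k≤l u v)) a)) in
  (λ i → inject≤ (s i) (k≤l i)) , inj

sum-cong : {k l : Fin n → ℕ} → (∀ i → k i ≡ l i) → sum k ≡ sum l
sum-cong {zero}  eq = refl
sum-cong {suc n} eq = cong₂ _+_ (eq zero) (sum-cong (eq ∘ suc))

≤-sum : (k : Fin n → ℕ) → ∀ i → k i ≤ sum k
≤-sum k zero    = m≤m+n _ _
≤-sum k (suc i) = ≤-trans (≤-sum (k ∘ suc) i) (m≤n+m _ (k zero))

replicationForcedAt? : (H : Graph (Fin n)) → Decidable (ReplicationForcedAt H)
replicationForcedAt? {n} H m =
  map′ (λ { (k , q) → toℕ ∘ k , q })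
       (λ { (k , pos , refl , h) →
            (λ i → fromℕ< (s≤s (≤-sum k i))) ,
            Q-cong (λ i → sym (toℕ-fromℕ< (s≤s (≤-sum k i)))) (pos , refl , h) })
       (search-Π refl (λ _ → search-Fin {suc m}) (λ k≗l → Q-cong (cong toℕ ∘ k≗l))
         (λ k → all? (λ i → 1 ≤? toℕ (k i)) ×-dec
                (sum (toℕ ∘ k) ≟ⁿ m) ×-dec forcesChoice? H (toℕ ∘ k)))
  where
  Q-cong : ∀ {m} {k l : Fin n → ℕ} → (∀ i → k i ≡ l i) →
           (∀ i → 1 ≤ k i) × sum k ≡ m × ForcesChoice H k →
           (∀ i → 1 ≤ l i) × sum l ≡ m × ForcesChoice H l
  Q-cong eq (pos , s , h) =
    (λ i → subst (1 ≤_) (eq i) (pos i)) ,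
    trans (sym (sum-cong eq)) s ,
    forcesChoice-mono H (≤-reflexive ∘ eq) h

sameClique-adj : (H : Graph (Fin n)) (k : Fin n → ℕ) → ∀ i {x y : Fin (k i)} →
                 x ≢ y → T (replicationAdj H k (i , x) (i , y))
sameClique-adj H k i {x} {y} x≢y with i ≟ i
... | no ¬p = contradiction refl ¬p
... | yes _ with toℕ x ≟ⁿ toℕ y
...   | yes p = contradiction (toℕ-injective p) x≢y
...   | no  _ = _

greedy : ∀ {N} → n ≤ N → (c : Fin n → Fin N → ℕ) → (∀ i → Injective _≡_ _≡_ (c i)) →
         Σ (Fin n → Fin N) λ s → Injective _≡_ _≡_ (λ i → c i (s i))
greedy {zero}  n≤N c inj = (λ ()) , λ { {()} }
greedy {suc n} n<N c inj with greedy (≤-trans (n≤1+n n) n<N) (c ∘ suc) (λ i → inj (suc i))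
... | s , s-inj with any? (λ x → all? λ i → ¬? (c zero x ≟ⁿ c (suc i) (s i)))
...   | yes (x , fresh) = cons x s , λ {i} {j} → cons-inj i j
  where
  cons-inj : ∀ i j → c i (cons x s i) ≡ c j (cons x s j) → i ≡ j
  cons-inj zero    zero    eq = refl
  cons-inj zero    (suc j) eq = contradiction eq (fresh j)
  cons-inj (suc i) zero    eq = contradiction (sym eq) (fresh i)
  cons-inj (suc i) (suc j) eq = cong suc (s-inj eq)
...   | no ∄fresh =
          let i , j , i<j , eq = pigeonhole n<N (proj₁ ∘ clash) in
          contradiction
            (inj zero (trans (proj₂ (clash i))
              (trans (cong (λ t → c (suc t) (s t)) eq) (sym (proj₂ (clash j))))))
            (<⇒≢ i<j)
  where
  clash : ∀ x → ∃ λ i → c zero x ≡ c (suc i) (s i)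
  clash x with any? (λ i → c zero x ≟ⁿ c (suc i) (s i))
  ... | yes p = p
  ... | no ∄p = contradiction (x , λ i p → ∄p (i , p)) ∄fresh

-- Cliques of order n suffice: choose greedily.
replicationForcedAt-∃ : (H : Graph (Fin n)) → ∃ (ReplicationForcedAt H)
replicationForcedAt-∃ {n} H = _ , (λ _ → n) , (λ { zero → s≤s z≤n ; (suc _) → s≤s z≤n }) , refl ,
  λ c prop → greedy ≤-refl (λ i x → c (i , x)) λ i {x} {y} eq →
    decidable-stable (x ≟ y) λ x≢y → prop _ _ (sameClique-adj H (λ _ → n) i x≢y) eq

forcedAt-∃ : (H : Graph (Fin n)) → ∃ (ForcedAt H)
forcedAt-∃ H = sum k , G , λ c prop →
  let s , inj = h (c ∘ to) (λ u v a → prop (to u) (to v)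
        (subst T (sym (cong₂ (replicationAdj H k) (strictlyInverseʳ u) (strictlyInverseʳ v))) a))
  in (λ i → to (i , s i)) , inj ∘ cong c , copy s , inj
  where
  k = proj₁ (proj₂ (replicationForcedAt-∃ H))
  h = proj₂ (proj₂ (proj₂ (proj₂ (replicationForcedAt-∃ H))))

  open Inverse (Blowup↔Fin k) using (to; from; strictlyInverseʳ)

  G : Graph (Fin (sum k))
  G = record
    { adj       = λ u v → replicationAdj H k (from u) (from v)
    ; symmetric = λ u v → replicationAdj-sym H k (from u) (from v)
    ; loopless  = λ v → replicationAdj-irr H k (from v)
    }

  choice-adj : (s : ∀ i → Fin (k i)) → ∀ i j →
               replicationAdj H k (i , s i) (j , s j) ≡ adj H i j
  choice-adj s i j with i ≟ j
  ... | no _ = refl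
  ... | yes refl with toℕ (s i) ≟ⁿ toℕ (s i)
  ...   | yes _ = sym (loopless H i)
  ...   | no ¬p = contradiction refl ¬p

  copy : (s : ∀ i → Fin (k i)) → ∀ i j →
         adj G (to (i , s i)) (to (j , s j)) ≡ adj H i j
  copy s i j = trans
    (cong₂ (replicationAdj H k) (strictlyInverseʳ (i , s i)) (strictlyInverseʳ (j , s j)))
    (choice-adj s i j)

ρ-minimum : (H : Graph (Fin n)) → ∃ (Least (ForcedAt H))
ρ-minimum H = least (forcedAt? H) (proj₁ r) (proj₂ r)
  where r = forcedAt-∃ H

ρᴿ-minimum : (H : Graph (Fin n)) → ∃ (Least (ReplicationForcedAt H))
ρᴿ-minimum H = least (replicationForcedAt? H) (proj₁ r) (proj₂ r)
  where r = replicationForcedAt-∃ H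

ρ : Graph (Fin n) → ℕ
ρ H = proj₁ (ρ-minimum H)

ρᴿ : Graph (Fin n) → ℕ
ρᴿ H = proj₁ (ρᴿ-minimum H)

ρ-least : (H : Graph (Fin n)) → Least (ForcedAt H) (ρ H)
ρ-least H = proj₂ (ρ-minimum H)

ρᴿ-least : (H : Graph (Fin n)) → Least (ReplicationForcedAt H) (ρᴿ H)
ρᴿ-least H = proj₂ (ρᴿ-minimum H)

SpanningSubgraph : Graph V → Graph V → Set
SpanningSubgraph H′ H = ∀ u v → T (adj H′ u v) → T (adj H u v)

-- parts identifies V(H) with the disjoint union of V(H₁) and V(H₂); edges of H
-- between the two sides are unconstrained.
record Union (H₁ : Graph (Fin a)) (H₂ : Graph (Fin b)) (H : Graph (Fin n)) : Set where
  field
    parts  : (Fin a ⊎ Fin b) ↔ Fin n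

  left : Fin a → Fin n
  left = Inverse.to parts ∘ inj₁

  right : Fin b → Fin n
  right = Inverse.to parts ∘ inj₂

  field
    left-adj  : ∀ u u′ → adj H (left u) (left u′) ≡ adj H₁ u u′
    right-adj : ∀ v v′ → adj H (right v) (right v′) ≡ adj H₂ v v′

  nonAdjacentPairs : ℕ
  nonAdjacentPairs = ∑[ u < a ] ∑[ v < b ] (if adj H (left u) (right v) then 0 else 1)

{-# OPTIONS --safe #-}

-- A colouring of a replication graph is proper iff it is injective on every
-- clique and separates the cliques of adjacent vertices.  Hence proper
-- colourings pull back along edge-preserving maps, which gives (ii), and a
-- colouring of the part of the replication graph over an induced subgraph
-- extends by fresh colours, which gives the lower bound of (iii).
-- For the upper bound, enlarge the clique of each u ∈ H₁ by the number of
-- vertices of H₂ not adjacent to u.  Given a proper colouring, first choose a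
-- rainbow H₂; each clique over u contains at most one vertex of each chosen
-- colour, and none for the neighbours of u, so after deleting the clashing
-- vertices enough remain to choose a rainbow H₁.
module Submission where

open import Defs
open import Data.Bool using (Bool; true; false; T; if_then_else_)
open import Data.Bool.Properties using (T?)
open import Data.Fin using (Fin; zero; suc; toℕ; _≟_; punchIn; splitAt; cast)
open import Data.Fin.Properties
  using (any?; punchIn-injective; punchInᵢ≢i; toℕ-injective; +↔⊎; toℕ-cast)
open import Data.Nat using (ℕ; zero; suc; _+_; _*_; _≤_; _≥_)
  renaming (_≟_ to _≟ⁿ_)
open import Data.Nat.Properties
  using (even≢odd; suc-injective; *-cancelˡ-≡; +-assoc; +-comm; +-mono-≤;
         +-0-commutativeMonoid; ≤-trans; m≤n+m; module ≤-Reasoning)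
open import Algebra.Properties.CommutativeMonoid.Sum +-0-commutativeMonoid
  using (sum-permute; ∑-distrib-+)
open import Data.Product using (Σ; _×_; _,_; proj₁; proj₂)
open import Data.Sum using (_⊎_; inj₁; inj₂; [_,_]; map₁)
open import Data.Sum.Properties using (inj₁-injective; inj₂-injective)
open import Function using (_∘_; id)
open import Function.Bundles using (_↔_; Inverse; Injection)
open import Function.Construct.Composition using (_↔-∘_)
open import Function.Definitions using (Injective)
open import Function.Properties.Inverse using (↔⇒↣)
open import Relation.Binary.PropositionalEquality
  using (_≡_; _≢_; refl; sym; trans; cong; cong₂; subst; module ≡-Reasoning)
open import Relation.Nullary using (¬_; yes; no; contradiction)
open import Relation.Nullary.Decidable using (decidable-stable)

private
  variable
    a b n : ℕ
    V W   : Set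

-- Replication graphs as graphs that force rainbow copies.

↔-injective : (φ : V ↔ W) → Injective _≡_ _≡_ (Inverse.to φ)
↔-injective φ = Injection.injective (↔⇒↣ φ)

choice-adj : (H : Graph (Fin n)) (k : Fin n → ℕ) (s : ∀ i → Fin (k i)) → ∀ i j →
             adj (replication H k) (i , s i) (j , s j) ≡ adj H i j
choice-adj H k s i j with i ≟ j
... | no _ = refl
... | yes refl with toℕ (s i) ≟ⁿ toℕ (s i)
...   | yes _ = sym (loopless H i)
...   | no ¬p = contradiction refl ¬p

forcesChoice⇒forces : (H : Graph (Fin n)) (k : Fin n → ℕ) →
                      ForcesChoice H k → Forces H (replication H k)
forcesChoice⇒forces H k h c prop =
  let s , inj = h c prop in
  (λ i → i , s i) , cong proj₁ , choice-adj H k s , inj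

-- `ForcedAt` asks for a graph on `Fin m`, whereas a replication graph lives on `Blowup k`;
-- relabelling along a bijection bridges the two.
forces-transport : ∀ {m} (H : Graph W) (G : Graph V) → V ↔ Fin m →
                   Forces H G → Σ (Graph (Fin m)) (Forces H)
forces-transport {m = m} H G V↔ h = G′ , λ c prop →
  let f , inj , copy , rainbow = h (c ∘ to)
        (λ u v e → prop (to u) (to v) (subst T (sym (to-adj u v)) e)) in
  to ∘ f , inj ∘ ↔-injective V↔ ,
  (λ i j → trans (to-adj (f i) (f j)) (copy i j)) , rainbow
  where
  open Inverse V↔ using (to; from; strictlyInverseʳ)

  G′ : Graph (Fin m)
  G′ = record
    { adj       = λ u v → adj G (from u) (from v)
    ; symmetric = λ u v → symmetric G (from u) (from v)
    ; loopless  = λ v → loopless G (from v)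
    }

  to-adj : ∀ u v → adj G′ (to u) (to v) ≡ adj G u v
  to-adj u v = cong₂ (adj G) (strictlyInverseʳ u) (strictlyInverseʳ v)

-- Proper colourings, clique by clique.

CliqueProper : Graph (Fin n) → (k : Fin n → ℕ) → (Blowup k → ℕ) → Set
CliqueProper H k c =
  (∀ i → Injective _≡_ _≡_ (λ x → c (i , x))) ×
  (∀ i j → T (adj H i j) → ∀ x y → c (i , x) ≢ c (j , y))

differentClique-adj : (H : Graph (Fin n)) (k : Fin n → ℕ) → ∀ i j → T (adj H i j) →
                      ∀ x y → T (replicationAdj H k (i , x) (j , y))
differentClique-adj H k i j e x y with i ≟ j
... | no _     = e
... | yes refl = contradiction (subst T (loopless H i) e) λ ()

proper⇒cliqueProper : (H : Graph (Fin n)) (k : Fin n → ℕ) → ∀ c →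
                      Proper (replication H k) c → CliqueProper H k c
proper⇒cliqueProper H k c prop =
  (λ i {x} {y} eq → decidable-stable (x ≟ y) λ x≢y →
     prop _ _ (sameClique-adj H k i x≢y) eq) ,
  λ i j e x y → prop _ _ (differentClique-adj H k i j e x y)

cliqueProper⇒proper : (H : Graph (Fin n)) (k : Fin n → ℕ) → ∀ c →
                      CliqueProper H k c → Proper (replication H k) c
cliqueProper⇒proper H k c (inj , sep) (i , x) (j , y) e eq with i ≟ j
... | no _ = sep i j e x y eq
... | yes refl with toℕ x ≟ⁿ toℕ y
-- If `x` and `y` coincided, `e` would have type `T false`; only distinct vertices remain.
...   | no x≢y = x≢y (cong toℕ (inj i eq))

-- `CliqueProper` contains no test `i ≟ j`, so it pulls back without case analysis. This serves both
-- for comparing edge sets over the same cliques and for passing to one side of a union with some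
-- clique vertices discarded.
cliqueProper-pullback :
  (H : Graph (Fin n)) (k : Fin n → ℕ) (H₁ : Graph (Fin a)) (k₁ : Fin a → ℕ)
  (φ : Fin a → Fin n) → (∀ u v → T (adj H₁ u v) → T (adj H (φ u) (φ v))) →
  (e : ∀ u → Fin (k₁ u) → Fin (k (φ u))) → (∀ u → Injective _≡_ _≡_ (e u)) →
  ∀ c → CliqueProper H k c → CliqueProper H₁ k₁ (λ (u , x) → c (φ u , e u x))
cliqueProper-pullback H k H₁ k₁ φ φ-adj e e-inj c (inj , sep) =
  (λ u eq → e-inj u (inj (φ u) eq)) ,
  λ u v uv x y → sep (φ u) (φ v) (φ-adj u v uv) (e u x) (e v y)

forcesChoice-addEdges : (H H′ : Graph (Fin n)) → SpanningSubgraph H′ H →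
                        (k : Fin n → ℕ) → ForcesChoice H′ k → ForcesChoice H k
forcesChoice-addEdges H H′ H′⊆H k h c prop =
  h c (cliqueProper⇒proper H′ k c
    (cliqueProper-pullback H k H′ k id H′⊆H (λ _ → id) (λ _ → id) c
      (proper⇒cliqueProper H k c prop)))

-- Extending a colouring from an induced subgraph.

module _ (H : Graph (Fin n)) (k : Fin n → ℕ) (H₁ : Graph (Fin a))
  (φ : Fin a → Fin n) (φ-inj : Injective _≡_ _≡_ φ)
  (φ-adj : ∀ u v → adj H (φ u) (φ v) ≡ adj H₁ u v) where

  position : Blowup k → ℕ
  position = toℕ ∘ Inverse.to (Blowup↔Fin k)

  -- Parity keeps the fresh colours apart from those of c, so no bound on c is needed.
  extend : (Blowup (k ∘ φ) → ℕ) → Blowup k → ℕ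
  extend c (i , x) with any? (λ u → φ u ≟ i)
  ... | yes (u , p) = 2 * c (u , subst (Fin ∘ k) (sym p) x)
  ... | no  _       = suc (2 * position (i , x))

  extend-φ : ∀ c u x → extend c (φ u , x) ≡ 2 * c (u , x)
  extend-φ c u x with any? (λ u′ → φ u′ ≟ φ u)
  ... | no ∄p = contradiction (u , refl) ∄p
  ... | yes (u′ , p) with φ-inj p
  -- The search may return any preimage of `φ u`; injectivity makes it `u`. Then `p` is a loop,
  -- hence `refl`, and the `subst` in `extend` disappears.
  ...   | refl with p
  ...     | refl = refl

  odd-injective : ∀ {u v} → suc (2 * position u) ≡ suc (2 * position v) → u ≡ v
  odd-injective eq =
    ↔-injective (Blowup↔Fin k) (toℕ-injective (*-cancelˡ-≡ _ _ 2 (suc-injective eq)))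

  -- Cliques over the image of `φ` inherit properness from `c`, vertices elsewhere get pairwise
  -- distinct odd colours, and parity separates the two kinds.
  extend-proper : ∀ c → CliqueProper H₁ (k ∘ φ) c → CliqueProper H k (extend c)
  extend-proper c (inj , sep) = inj′ , sep′
    where
    inj′ : ∀ i → Injective _≡_ _≡_ (λ x → extend c (i , x))
    inj′ i eq with any? (λ u → φ u ≟ i)
    ... | yes (u , refl) = inj u (*-cancelˡ-≡ _ _ 2 eq)
    ... | no _ with odd-injective eq
    ...   | refl = refl

    sep′ : ∀ i j → T (adj H i j) → ∀ x y → extend c (i , x) ≢ extend c (j , y)
    sep′ i j e x y eq with any? (λ u → φ u ≟ i) | any? (λ u → φ u ≟ j)
    ... | yes (u , refl) | yes (v , refl) =
      sep u v (subst T (φ-adj u v) e) x y (*-cancelˡ-≡ _ _ 2 eq)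
    ... | yes (u , refl) | no _ = even≢odd (c (u , x)) (position (j , y)) eq
    ... | no _ | yes (v , refl) = even≢odd (c (v , y)) (position (i , x)) (sym eq)
    ... | no _ | no _ with odd-injective eq
    -- Equal fresh colours mean equal vertices, so the edge `e` would be a loop.
    ...   | refl = subst T (loopless H i) e

  forcesChoice-induced : ForcesChoice H k → ForcesChoice H₁ (k ∘ φ)
  forcesChoice-induced h c prop =
    let s , inj = h (extend c) (cliqueProper⇒proper H k (extend c)
          (extend-proper c (proper⇒cliqueProper H₁ (k ∘ φ) c prop))) in
    s ∘ φ , λ {u} {v} eq → φ-inj (inj
      (trans (extend-φ c u (s (φ u)))
        (trans (cong (2 *_) eq) (sym (extend-φ c v (s (φ v)))))))

-- Deleting forbidden colours from a clique.

avoid-one : ∀ {m} (c : Fin (suc m) → ℕ) → Injective _≡_ _≡_ c → ∀ z →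
            Σ (Fin (suc m)) λ i → ∀ x → c (punchIn i x) ≢ z
avoid-one c inj z with any? (λ i → c i ≟ⁿ z)
... | yes (i , p) = i , λ x q → punchInᵢ≢i i x (inj (trans q (sym p)))
-- A vertex is dropped even when none has colour `z`, so that the number left is always the same.
... | no ∄p       = zero , λ x q → ∄p (_ , q)

-- Each `v` that is not allowed costs one application of `avoid-one`, an allowed one costs nothing.
-- The size `m` is tied down by an equation so that cliques whose size is known only propositionally
-- are covered.
avoid : (allowed : Fin b → Bool) (g : Fin b → ℕ) → ∀ {k m} →
        m ≡ (∑[ v < b ] (if allowed v then 0 else 1)) + k →
        (c : Fin m → ℕ) → Injective _≡_ _≡_ c →
        Σ (Fin k → Fin m) λ e → Injective _≡_ _≡_ e ×
          (∀ v → ¬ T (allowed v) → ∀ x → c (e x) ≢ g v)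
avoid {zero} allowed g refl c inj = id , id , λ ()
avoid {suc b} allowed g eq c inj with allowed zero in allowed₀
... | true =
  let e , e-inj , avoids = avoid (allowed ∘ suc) (g ∘ suc) eq c inj in
  e , e-inj , λ where
    zero    ¬t → contradiction (subst T (sym allowed₀) _) ¬t
    (suc v) ¬t → avoids v ¬t
avoid {suc b} allowed g refl c inj | false =
  let i , avoids₀ = avoid-one c inj (g zero)
      e , e-inj , avoids = avoid (allowed ∘ suc) (g ∘ suc) refl (c ∘ punchIn i)
                             (λ eq → punchIn-injective i _ _ (inj eq)) in
  punchIn i ∘ e , (λ eq → e-inj (punchIn-injective i _ _ eq)) , λ where
    zero    _  x → avoids₀ (e x)
    (suc v) ¬t x → avoids v ¬t x

-- Splitting sums along a disjoint union.

sum-splitAt : ∀ a {b} (f : Fin a ⊎ Fin b → ℕ) →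
              sum (f ∘ splitAt a) ≡ sum (f ∘ inj₁) + sum (f ∘ inj₂)
sum-splitAt zero    f = refl
sum-splitAt (suc a) f =
  trans (cong (f (inj₁ zero) +_) (sum-splitAt a (f ∘ map₁ suc)))
        (sym (+-assoc (f (inj₁ zero)) _ _))

sum-parts : (π : (Fin a ⊎ Fin b) ↔ Fin n) (k : Fin n → ℕ) →
  sum k ≡ sum (k ∘ Inverse.to π ∘ inj₁) + sum (k ∘ Inverse.to π ∘ inj₂)
sum-parts {a} π k =
  trans (sum-permute k (π ↔-∘ +↔⊎)) (sum-splitAt a (k ∘ Inverse.to π))

-- Bounds for a union of two graphs.

module _ {H : Graph (Fin n)} {H₁ : Graph (Fin a)} {H₂ : Graph (Fin b)}
  (U : Union H₁ H₂ H) where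

  open Union U
  open Inverse parts using (to; from; strictlyInverseˡ; strictlyInverseʳ)

  left-injective : Injective _≡_ _≡_ left
  left-injective = inj₁-injective ∘ ↔-injective parts

  right-injective : Injective _≡_ _≡_ right
  right-injective = inj₂-injective ∘ ↔-injective parts

  nonNeighbours : Fin a → ℕ
  nonNeighbours u = ∑[ v < b ] (if adj H (left u) (right v) then 0 else 1)

  -- Choices for a union are built over `Fin a ⊎ Fin b`. Since `to (from i)` is `i` only
  -- propositionally, the chosen vertex is carried along that equality, which preserves its colour.
  choice-transport : {k : Fin n → ℕ} (c : Blowup k → ℕ)
    (t : ∀ p → Fin (k (to p))) → Injective _≡_ _≡_ (λ p → c (to p , t p)) →
    Σ (∀ i → Fin (k i)) λ s → Injective _≡_ _≡_ (λ i → c (i , s i))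
  choice-transport {k} c t inj =
    (λ i → subst (Fin ∘ k) (strictlyInverseˡ i) (t (from i))) ,
    λ {i} {j} eq →
      trans (sym (strictlyInverseˡ i))
        (trans (cong to (inj (trans (moved (strictlyInverseˡ i) _)
                               (trans eq (sym (moved (strictlyInverseˡ j) _))))))
               (strictlyInverseˡ j))
    where
    moved : ∀ {i j} (p : i ≡ j) x → c (i , x) ≡ c (j , subst (Fin ∘ k) p x)
    moved refl x = refl

  forcesChoice-union : {k : Fin n → ℕ} {k₁ : Fin a → ℕ} {k₂ : Fin b → ℕ} →
    (∀ u → k (left u) ≡ nonNeighbours u + k₁ u) → (∀ v → k (right v) ≡ k₂ v) →
    ForcesChoice H₁ k₁ → ForcesChoice H₂ k₂ → ForcesChoice H k
  forcesChoice-union {k} {k₁} {k₂} k-left k-right h₁ h₂ c prop =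
    choice-transport c t t-inj
    where
    cprop : CliqueProper H k c
    cprop = proper⇒cliqueProper H k c prop

    r : ∀ v → Fin (k₂ v) → Fin (k (right v))
    r v = cast (sym (k-right v))

    r-inj : ∀ v → Injective _≡_ _≡_ (r v)
    r-inj v {x} {y} eq = toℕ-injective
      (trans (sym (toℕ-cast _ x)) (trans (cong toℕ eq) (toℕ-cast _ y)))

    choice₂ : Σ (∀ v → Fin (k₂ v)) λ s → Injective _≡_ _≡_ (λ v → c (right v , r v (s v)))
    choice₂ = h₂ _ (cliqueProper⇒proper H₂ k₂ _
      (cliqueProper-pullback H k H₂ k₂ right
        (λ u v → subst T (sym (right-adj u v))) r r-inj c cprop))

    s₂ : ∀ v → Fin (k₂ v)
    s₂ = proj₁ choice₂

    kept : ∀ u → Σ (Fin (k₁ u) → Fin (k (left u))) λ e → Injective _≡_ _≡_ e ×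
             (∀ v → ¬ T (adj H (left u) (right v)) →
              ∀ x → c (left u , e x) ≢ c (right v , r v (s₂ v)))
    kept u = avoid (λ v → adj H (left u) (right v)) (λ v → c (right v , r v (s₂ v)))
               (k-left u) (λ x → c (left u , x)) (proj₁ cprop (left u))

    l : ∀ u → Fin (k₁ u) → Fin (k (left u))
    l u = proj₁ (kept u)

    -- Pulling back along `l` offers only the kept vertices, so no choice made here can repeat the
    -- colour chosen at a non-neighbour in `H₂`.
    choice₁ : Σ (∀ u → Fin (k₁ u)) λ s → Injective _≡_ _≡_ (λ u → c (left u , l u (s u)))
    choice₁ = h₁ _ (cliqueProper⇒proper H₁ k₁ _
      (cliqueProper-pullback H k H₁ k₁ left
        (λ u v → subst T (sym (left-adj u v))) l (λ u → proj₁ (proj₂ (kept u))) c cprop))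

    s₁ : ∀ u → Fin (k₁ u)
    s₁ = proj₁ choice₁

    t : ∀ p → Fin (k (to p))
    t (inj₁ u) = l u (s₁ u)
    t (inj₂ v) = r v (s₂ v)

    across : ∀ u v → c (left u , l u (s₁ u)) ≢ c (right v , r v (s₂ v))
    across u v with T? (adj H (left u) (right v))
    ... | yes e = proj₂ cprop (left u) (right v) e _ _
    ... | no ¬e = proj₂ (proj₂ (kept u)) v ¬e (s₁ u)

    t-inj : Injective _≡_ _≡_ (λ p → c (to p , t p))
    t-inj {inj₁ u} {inj₁ v} eq = cong inj₁ (proj₂ choice₁ eq)
    t-inj {inj₁ u} {inj₂ v} eq = contradiction eq (across u v)
    t-inj {inj₂ u} {inj₁ v} eq = contradiction (sym eq) (across v u)
    t-inj {inj₂ u} {inj₂ v} eq = cong inj₂ (proj₂ choice₂ eq)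

  -- Over each side, a forcing replication graph of `H` restricts to a forcing one for that side,
  -- and the two orders add up to `m`.
  union-lower : ∀ {m₁ m₂ m} → Least (ReplicationForcedAt H₁) m₁ →
    Least (ReplicationForcedAt H₂) m₂ → Least (ReplicationForcedAt H) m → m₁ + m₂ ≤ m
  union-lower {m₁} {m₂} {m} (_ , min₁) (_ , min₂) ((k , pos , size , h) , _) = begin
    m₁ + m₂
      ≤⟨ +-mono-≤
           (min₁ _ (k ∘ left , pos ∘ left , refl ,
             forcesChoice-induced H k H₁ left left-injective left-adj h))
           (min₂ _ (k ∘ right , pos ∘ right , refl ,
             forcesChoice-induced H k H₂ right right-injective right-adj h)) ⟩
    sum (k ∘ left) + sum (k ∘ right) ≡⟨ sum-parts parts k ⟨
    sum k                            ≡⟨ size ⟩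
    m                                ∎
    where open ≤-Reasoning

  union-upper : ∀ {m₁ m₂ m} → Least (ReplicationForcedAt H₁) m₁ →
    Least (ReplicationForcedAt H₂) m₂ → Least (ReplicationForcedAt H) m →
    m ≤ m₁ + m₂ + nonAdjacentPairs
  union-upper {m₁} {m₂} ((k₁ , pos₁ , size₁ , h₁) , _) ((k₂ , pos₂ , size₂ , h₂) , _) (_ , min) =
    min _ (κ ∘ from , κ-pos ∘ from , size , forcesChoice-union κ-left κ-right h₁ h₂)
    where
    κ : Fin a ⊎ Fin b → ℕ
    κ = [ (λ u → nonNeighbours u + k₁ u) , k₂ ]

    κ-pos : ∀ p → 1 ≤ κ p
    κ-pos (inj₁ u) = ≤-trans (pos₁ u) (m≤n+m (k₁ u) _)
    κ-pos (inj₂ v) = pos₂ v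

    κ-left : ∀ u → κ (from (left u)) ≡ nonNeighbours u + k₁ u
    κ-left u = cong κ (strictlyInverseʳ (inj₁ u))

    κ-right : ∀ v → κ (from (right v)) ≡ k₂ v
    κ-right v = cong κ (strictlyInverseʳ (inj₂ v))

    open ≡-Reasoning

    size : sum (κ ∘ from) ≡ m₁ + m₂ + nonAdjacentPairs
    size = begin
      sum (κ ∘ from)
        ≡⟨ sum-parts parts (κ ∘ from) ⟩
      sum (κ ∘ from ∘ left) + sum (κ ∘ from ∘ right)
        ≡⟨ cong₂ _+_ (sum-cong κ-left) (sum-cong κ-right) ⟩
      sum (λ u → nonNeighbours u + k₁ u) + sum k₂
        -- By definition `nonAdjacentPairs` is the sum of `nonNeighbours`, so the enlargement of the
        -- cliques is exactly the extra term.
        ≡⟨ cong (_+ sum k₂) (∑-distrib-+ nonNeighbours k₁) ⟩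
      nonAdjacentPairs + sum k₁ + sum k₂
        ≡⟨ +-assoc nonAdjacentPairs (sum k₁) (sum k₂) ⟩
      nonAdjacentPairs + (sum k₁ + sum k₂)
        ≡⟨ +-comm nonAdjacentPairs _ ⟩
      sum k₁ + sum k₂ + nonAdjacentPairs
        ≡⟨ cong (_+ nonAdjacentPairs) (cong₂ _+_ size₁ size₂) ⟩
      m₁ + m₂ + nonAdjacentPairs ∎

-- Comparison of the minima.

replicationForced⇒forced : (H : Graph (Fin n)) → ∀ {m} →
                           ReplicationForcedAt H m → ForcedAt H m
replicationForced⇒forced H (k , _ , size , h) = subst (ForcedAt H) size
  (forces-transport H (replication H k) (Blowup↔Fin k) (forcesChoice⇒forces H k h))

replicationForced-addEdges : (H H′ : Graph (Fin n)) → SpanningSubgraph H′ H → ∀ {m} →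
                             ReplicationForcedAt H′ m → ReplicationForcedAt H m
replicationForced-addEdges H H′ H′⊆H (k , pos , size , h) =
  k , pos , size , forcesChoice-addEdges H H′ H′⊆H k h

theorem4p1 : {n : ℕ} (H : Graph (Fin n)) →
    (ρ H ≤ ρᴿ H)
    × ((H′ : Graph (Fin n)) → SpanningSubgraph H′ H → ρᴿ H′ ≥ ρᴿ H)
    × ({a b : ℕ} (H₁ : Graph (Fin a)) (H₂ : Graph (Fin b)) (U : Union H₁ H₂ H) →
    (ρᴿ H₁ + ρᴿ H₂ ≤ ρᴿ H)
    × (ρᴿ H ≤ ρᴿ H₁ + ρᴿ H₂ + Union.nonAdjacentPairs U))
theorem4p1 H =
  proj₂ (ρ-least H) (ρᴿ H) (replicationForced⇒forced H (proj₁ (ρᴿ-least H))) ,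
  (λ H′ H′⊆H → proj₂ (ρᴿ-least H) (ρᴿ H′)
    (replicationForced-addEdges H H′ H′⊆H (proj₁ (ρᴿ-least H′)))) ,
  λ H₁ H₂ U →
    union-lower U (ρᴿ-least H₁) (ρᴿ-least H₂) (ρᴿ-least H) ,
    union-upper U (ρᴿ-least H₁) (ρᴿ-least H₂) (ρᴿ-least H)
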